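{- For every $\alpha>0$ there is some $k_0$ such that for all integers $k\geq k_0$, every finite simple graph with at least one vertex and minimum degree at least $k+k^{\frac12+\alpha}$ has a $(k+1)$-edge-connected subgraph.
   Context: A graph $H$ is $(k+1)$-edge-connected if it has at least two vertices and for every partition of $V(H)$ into two nonempty sets, at least $k+1$ edges join the two sets. -}

module Defs where

open import Data.Nat using (ℕ; zero; suc; _+_; _*_; _∸_; _^_; _≤_)
open import Data.Fin using (Fin; zero; suc)
open import Data.Bool using (Bool; true; false; _∧_; not; if_then_else_)
open import Data.Product using (Σ; ∃; _×_)
open import Relation.Binary.PropositionalEquality using (_≡_)
open import Function.Definitions using (Injective)

sumF : ∀ {n} → (Fin n → ℕ) → ℕ
sumF {zero} f = 0
sumF {suc n} f = f zero + sumF (λ i → f (suc i))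

count : ∀ {n} → (Fin n → Bool) → ℕ
count P = sumF (λ i → if P i then 1 else 0)

record Graph (n : ℕ) : Set where
  field
    adj    : Fin n → Fin n → Bool
    sym    : ∀ u v → adj u v ≡ adj v u
    irrefl : ∀ v → adj v v ≡ false
open Graph public

degree : ∀ {n} → Graph n → Fin n → ℕ
degree G v = count (adj G v)

-- number of edges between A and its complement
-- (each such edge counted once, as the ordered pair (u ∈ A, v ∉ A))
crossing : ∀ {n} → Graph n → (Fin n → Bool) → ℕ
crossing G A = sumF (λ u → count (λ v → A u ∧ (not (A v) ∧ adj G u v)))

EdgeConnected : ℕ → ∀ {m} → Graph m → Set
EdgeConnected j {m} H =
  (2 ≤ m) ×
  ((A : Fin m → Bool) → (∃ λ u → A u ≡ true) → (∃ λ v → A v ≡ false) →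
     j ≤ crossing H A)

record Subgraph {n : ℕ} (G : Graph n) : Set where
  field
    m       : ℕ
    H       : Graph m
    emb     : Fin m → Fin n
    emb-inj : Injective _≡_ _≡_ emb
    edges   : ∀ u v → adj H u v ≡ true → adj G (emb u) (emb v) ≡ true
open Subgraph public

-- d ≥ k + k^(1/2 + p/q), for q ≥ 1, stated exactly over ℕ:
-- d ≥ k and (d - k)^(2q) ≥ k^(q + 2p)
DegBound : (p q k d : ℕ) → Set
DegBound p q k d = (k ≤ d) × (k ^ (q + 2 * p) ≤ (d ∸ k) ^ (2 * q))

-- Suppose every induced subgraph with at least two vertices has a cut with at most k edges, and
-- write d = k + s for the degree bound. Descend through smaller and smaller vertex sets X,
-- alternating two moves: retire (drop from X) a vertex with at most k neighbours in X; if there is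
-- none, pass to one side of a cut of X. Vertices outside X carry an age, 0 on retirement and growing
-- by one with every cut (vertices cut off are old, of age at least L, at once). A vertex of age i
-- has weight 3^i 2^(L-i), capped at W = 3^L, and Φ is the number of edges leaving X, each weighted
-- by its outer end.
--   A cut multiplies weights by at most 3/2 and adds weight at most W k on each side, so one of the
-- two sides has Φ' ≤ (3/4) Φ + k W, and Φ ≤ 4 k W persists. A retired vertex has at least s edges
-- leaving X, at most L T of them to young vertices if each age below L has at most T members; so it
-- removes at least W (s - L T) from Φ and adds at most 2^L k ≤ W. Hence Φ pays for retirements, at
-- most 4 k / (s - L T - 1) ≤ T between cuts. Since L can be logarithmic in k and T of order √k, this
-- works for s of order √k log k. Both sides of a small cut of a simple graph of minimum degree > k
-- have more than k + 1 > T vertices, so X never becomes empty and the descent cannot end.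
module Submission where

open import Defs renaming (sym to adj-sym)
open import Data.Bool using (Bool; true; false; _∧_; not; if_then_else_)
import Data.Bool.Properties as Bool
open import Data.Fin using (Fin; zero; suc; _≟_; fromℕ<)
open import Data.Fin.Properties using (any?; suc-injective)
open import Data.Fin.Subset using (Subset)
open import Data.Fin.Subset.Properties using (anySubset?)
open import Data.Nat using (ℕ; zero; suc; _+_; _*_; _∸_; _^_; _/_; _%_; _⊓_; _≤_; _<_; z≤n; s≤s; _≤?_; _≡ᵇ_; NonZero; >-nonZero)
  renaming (_≟_ to _≟ℕ_)
open import Data.Nat.DivMod using (m/n*n≤m; m≡m%n+[m/n]*n; m%n<n)
open import Data.Nat.Properties hiding (_≟_; suc-injective)
open import Data.Nat.Tactic.RingSolver using (solve-∀)
open import Data.Product using (Σ; ∃; _×_; _,_; proj₁; proj₂)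
open import Data.Sum using (_⊎_; inj₁; inj₂)
open import Data.Vec using (lookup; tabulate)
open import Data.Vec.Properties using (lookup∘tabulate)
open import Function using (_∘_)
open import Function.Definitions using (Injective)
open import Relation.Binary.PropositionalEquality
  using (_≡_; refl; sym; trans; cong; cong₂; subst; module ≡-Reasoning)
open import Relation.Nullary using (¬_; Dec; yes; no; does; contradiction)
open import Relation.Nullary.Decidable using (_×-dec_)

private variable n : ℕ

-- Finite sums, weighted sums and point masses.

sumF-cong : {f g : Fin n → ℕ} → (∀ i → f i ≡ g i) → sumF f ≡ sumF g
sumF-cong {zero} e = refl
sumF-cong {suc n} e = cong₂ _+_ (e zero) (sumF-cong (e ∘ suc))

sumF-mono : {f g : Fin n → ℕ} → (∀ i → f i ≤ g i) → sumF f ≤ sumF g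
sumF-mono {zero} e = z≤n
sumF-mono {suc n} e = +-mono-≤ (e zero) (sumF-mono (e ∘ suc))

sumF-+ : (f g : Fin n → ℕ) → sumF (λ i → f i + g i) ≡ sumF f + sumF g
sumF-+ {zero} f g = refl
sumF-+ {suc n} f g rewrite sumF-+ (f ∘ suc) (g ∘ suc) =
  shuffle (f zero) (g zero) (sumF (f ∘ suc)) (sumF (g ∘ suc))
  where
  shuffle : ∀ a b c d → a + b + (c + d) ≡ a + c + (b + d)
  shuffle = solve-∀

sumF-* : ∀ c (f : Fin n → ℕ) → sumF (λ i → c * f i) ≡ c * sumF f
sumF-* {zero} c f = sym (*-zeroʳ c)
sumF-* {suc n} c f rewrite sumF-* c (f ∘ suc) = sym (*-distribˡ-+ c (f zero) _)

sumF-0 : ∀ n → sumF {n} (λ _ → 0) ≡ 0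
sumF-0 zero = refl
sumF-0 (suc n) = sumF-0 n

sumF-1 : ∀ n → sumF {n} (λ _ → 1) ≡ n
sumF-1 zero = refl
sumF-1 (suc n) = cong suc (sumF-1 n)

sumF-swap : ∀ {m} (f : Fin m → Fin n → ℕ) →
  sumF (λ i → sumF (f i)) ≡ sumF (λ j → sumF (λ i → f i j))
sumF-swap {n} {zero} f = sym (sumF-0 n)
sumF-swap {n} {suc m} f rewrite sumF-swap (f ∘ suc) = sym (sumF-+ (f zero) _)

𝟙 : Bool → ℕ
𝟙 b = if b then 1 else 0

𝟙≤1 : ∀ b → 𝟙 b ≤ 1
𝟙≤1 true = ≤-refl
𝟙≤1 false = z≤n

sumF-nonzero : (P : Fin n → Bool) → 1 ≤ count P → ∃ λ i → P i ≡ true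
sumF-nonzero {suc n} P h with P zero in eq
... | true = zero , eq
... | false with sumF-nonzero (P ∘ suc) h
... | i , e = suc i , e

nonzero-sumF : (f : Fin n → ℕ) (i : Fin n) → f i ≤ sumF f
nonzero-sumF f zero = m≤m+n _ _
nonzero-sumF f (suc i) = ≤-trans (nonzero-sumF (f ∘ suc) i) (m≤n+m _ _)

dot : (f g : Fin n → ℕ) → ℕ
dot f g = sumF (λ i → f i * g i)

dot-comm : (f g : Fin n → ℕ) → dot f g ≡ dot g f
dot-comm f g = sumF-cong λ i → *-comm (f i) (g i)

dot-congˡ : {f f′ : Fin n → ℕ} (g : Fin n → ℕ) → (∀ i → f i ≡ f′ i) → dot f g ≡ dot f′ g
dot-congˡ g e = sumF-cong λ i → cong (_* g i) (e i)

dot-congʳ : (f : Fin n → ℕ) {g g′ : Fin n → ℕ} → (∀ i → g i ≡ g′ i) → dot f g ≡ dot f g′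
dot-congʳ f e = sumF-cong λ i → cong (f i *_) (e i)

dot-monoˡ : {f f′ : Fin n → ℕ} (g : Fin n → ℕ) → (∀ i → f i ≤ f′ i) → dot f g ≤ dot f′ g
dot-monoˡ g e = sumF-mono λ i → *-monoˡ-≤ (g i) (e i)

dot-monoʳ : (f : Fin n → ℕ) {g g′ : Fin n → ℕ} → (∀ i → g i ≤ g′ i) → dot f g ≤ dot f g′
dot-monoʳ f e = sumF-mono λ i → *-monoʳ-≤ (f i) (e i)

dot-+ˡ : (f f′ g : Fin n → ℕ) → dot (λ i → f i + f′ i) g ≡ dot f g + dot f′ g
dot-+ˡ f f′ g = trans (sumF-cong λ i → *-distribʳ-+ (g i) (f i) (f′ i))
  (sumF-+ (λ i → f i * g i) (λ i → f′ i * g i))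

dot-*ˡ : ∀ c (f g : Fin n → ℕ) → dot (λ i → c * f i) g ≡ c * dot f g
dot-*ˡ c f g = trans (sumF-cong λ i → *-assoc c (f i) (g i)) (sumF-* c (λ i → f i * g i))

dot-+ʳ : (f g g′ : Fin n → ℕ) → dot f (λ i → g i + g′ i) ≡ dot f g + dot f g′
dot-+ʳ f g g′ = trans (sumF-cong λ i → *-distribˡ-+ (f i) (g i) (g′ i))
  (sumF-+ (λ i → f i * g i) (λ i → f i * g′ i))

dot-*ʳ : ∀ c (f g : Fin n → ℕ) → dot f (λ i → c * g i) ≡ c * dot f g
dot-*ʳ c f g = trans (dot-comm f _) (trans (dot-*ˡ c g f) (cong (c *_) (dot-comm g f)))

dot≤sumF : (f g : Fin n → ℕ) → (∀ i → g i ≤ 1) → dot f g ≤ sumF f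
dot≤sumF f g h = sumF-mono λ i → ≤-trans (*-monoʳ-≤ (f i) (h i)) (≤-reflexive (*-identityʳ (f i)))

δ : Fin n → Fin n → ℕ
δ x v = 𝟙 (does (v ≟ x))

dot-δ : (x : Fin n) (f : Fin n → ℕ) → dot (δ x) f ≡ f x
dot-δ {suc n} zero f = trans (cong₂ _+_ (*-identityˡ (f zero)) (sumF-0 n)) (+-identityʳ _)
dot-δ (suc x) f = dot-δ x (f ∘ suc)

sumF-δ : (x : Fin n) → sumF (δ x) ≡ 1
sumF-δ x = trans (sumF-cong λ v → sym (*-identityʳ (δ x v))) (dot-δ x (λ _ → 1))

-- Enumerating a vertex subset.

-- Made for induced subgraphs, whose vertices must be numbered afresh: `sum-elem` turns sums over
-- the new numbering into sums weighted by the indicator of `X`, and `extend` carries a subset back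
-- to the original vertices.
record Enumeration (X : Fin n → Bool) : Set where
  field
    size : ℕ
    elem : Fin size → Fin n
    elem-injective : Injective _≡_ _≡_ elem
    elem∈ : ∀ i → X (elem i) ≡ true
    sum-elem : ∀ f → sumF (f ∘ elem) ≡ dot (𝟙 ∘ X) f
    extend : (Fin size → Bool) → Fin n → Bool
    extend-elem : ∀ A i → extend A (elem i) ≡ A i
    extend⊆ : ∀ A v → extend A v ≡ true → X v ≡ true

enumerate : (X : Fin n → Bool) → Enumeration X
enumerate {zero} X = record
  { size = 0 ; elem = λ () ; elem-injective = λ { {()} } ; elem∈ = λ ()
  ; sum-elem = λ _ → refl ; extend = λ _ () ; extend-elem = λ _ () ; extend⊆ = λ _ () }
enumerate {suc n} X with enumerate (X ∘ suc) | X zero in eq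
... | rest | false = record
  { size = size
  ; elem = suc ∘ elem
  ; elem-injective = elem-injective ∘ suc-injective
  ; elem∈ = elem∈
  ; sum-elem = λ f → trans (sum-elem (f ∘ suc))
      (cong (λ b → 𝟙 b * f zero + dot (𝟙 ∘ X ∘ suc) (f ∘ suc)) (sym eq))
  ; extend = λ { A zero → false ; A (suc v) → extend A v }
  ; extend-elem = extend-elem
  ; extend⊆ = λ { A zero () ; A (suc v) → extend⊆ A v } }
  where open Enumeration rest
... | rest | true = record
  { size = suc size
  ; elem = λ { zero → zero ; (suc i) → suc (elem i) }
  ; elem-injective = λ { {zero} {zero} _ → refl ; {zero} {suc _} () ; {suc _} {zero} ()
                       ; {suc _} {suc _} e → cong suc (elem-injective (suc-injective e)) }
  ; elem∈ = λ { zero → eq ; (suc i) → elem∈ i }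
  ; sum-elem = λ f → trans
      (cong₂ _+_ (sym (*-identityˡ (f zero))) (sum-elem (f ∘ suc)))
      (cong (λ b → 𝟙 b * f zero + dot (𝟙 ∘ X ∘ suc) (f ∘ suc)) (sym eq))
  ; extend = λ { A zero → A zero ; A (suc v) → extend (A ∘ suc) v }
  ; extend-elem = λ { A zero → refl ; A (suc i) → extend-elem (A ∘ suc) i }
  ; extend⊆ = λ { A zero _ → eq ; A (suc v) → extend⊆ (A ∘ suc) v } }
  where open Enumeration rest

-- Small cuts and edge-connectivity.

crossing-term : ∀ a b c → 𝟙 (a ∧ (not b ∧ c)) ≡ 𝟙 a * (𝟙 (not b) * 𝟙 c)
crossing-term false b c = refl
crossing-term true true c = refl
crossing-term true false true = refl
crossing-term true false false = refl

crossing-cong : (G : Graph n) {A B : Fin n → Bool} → (∀ v → A v ≡ B v) →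
  crossing G A ≡ crossing G B
crossing-cong G e = sumF-cong λ u → sumF-cong λ v →
  cong₂ (λ a b → 𝟙 (a ∧ (not b ∧ adj G u v))) (e u) (e v)

SmallCut : ℕ → Graph n → (Fin n → Bool) → Set
SmallCut k G A = (∃ λ u → A u ≡ true) × (∃ λ v → A v ≡ false) × crossing G A ≤ k

-- Finite search over all cuts. It runs over Boolean vectors; an arbitrary predicate is tabulated
-- first, and `crossing-cong` shows that this preserves the number of crossing edges.
smallCut⊎edgeConnected : ∀ k (G : Graph n) → 2 ≤ n →
  ∃ (SmallCut k G) ⊎ EdgeConnected (suc k) G
smallCut⊎edgeConnected {n} k G 2≤n with anySubset? cut?
  where
  cut? : (A : Subset n) → Dec (SmallCut k G (lookup A))
  cut? A = any? (λ u → lookup A u Bool.≟ true) ×-dec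
           (any? (λ v → lookup A v Bool.≟ false) ×-dec (crossing G (lookup A) ≤? k))
... | yes (A , cut) = inj₁ (lookup A , cut)
... | no none = inj₂ (2≤n , λ A (u , Au) (v , Av) → ≰⇒> λ small →
  none (tabulate A , (u , trans (lookup∘tabulate A u) Au) , (v , trans (lookup∘tabulate A v) Av) ,
    subst (_≤ k) (crossing-cong G (sym ∘ lookup∘tabulate A)) small))

𝟙-∧ : ∀ a b → 𝟙 (a ∧ b) ≡ 𝟙 a * 𝟙 b
𝟙-∧ true b = sym (*-identityˡ (𝟙 b))
𝟙-∧ false b = refl

-- Edge counts as a bilinear form; cuts of induced subgraphs.

module _ (G : Graph n) where

  edge : Fin n → Fin n → ℕ
  edge u v = 𝟙 (adj G u v)

  row : (Fin n → ℕ) → Fin n → ℕ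
  row g u = dot g (edge u)

  -- The bilinear form of the adjacency matrix. On indicators of disjoint sets it counts the edges
  -- between them; with general weights it also expresses the potential.
  E : (f g : Fin n → ℕ) → ℕ
  E f g = dot f (row g)

  edge-sym : ∀ u v → edge u v ≡ edge v u
  edge-sym u v = cong 𝟙 (adj-sym G u v)

  row≤sumF : ∀ f u → row f u ≤ sumF f
  row≤sumF f u = dot≤sumF f (edge u) λ v → 𝟙≤1 (adj G u v)

  degree≡row : ∀ u → degree G u ≡ row (λ _ → 1) u
  degree≡row u = sumF-cong λ v → sym (*-identityˡ (edge u v))

  E-double : ∀ f g → E f g ≡ sumF (λ u → sumF (λ v → f u * (g v * edge u v)))
  E-double f g = sumF-cong λ u → sym (sumF-* (f u) (λ v → g v * edge u v))

  E-sym : ∀ f g → E f g ≡ E g f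
  E-sym f g = begin
    E f g                                               ≡⟨ E-double f g ⟩
    sumF (λ u → sumF (λ v → f u * (g v * edge u v)))    ≡⟨ sumF-swap (λ u v → f u * (g v * edge u v)) ⟩
    sumF (λ v → sumF (λ u → f u * (g v * edge u v)))    ≡⟨ sumF-cong (λ v → sumF-cong λ u → flip u v) ⟩
    sumF (λ v → sumF (λ u → g v * (f u * edge v u)))    ≡⟨ E-double g f ⟨
    E g f                                               ∎
    where
    open ≡-Reasoning
    exchange : ∀ a b c → a * (b * c) ≡ b * (a * c)
    exchange = solve-∀
    flip : ∀ u v → f u * (g v * edge u v) ≡ g v * (f u * edge v u)
    flip u v = trans (cong (λ e → f u * (g v * e)) (edge-sym u v)) (exchange (f u) (g v) _)

  E-+ʳ : ∀ f g h → E f (λ v → g v + h v) ≡ E f g + E f h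
  E-+ʳ f g h = trans (dot-congʳ f λ u → dot-+ˡ g h (edge u)) (dot-+ʳ f (row g) (row h))

  E-*ʳ : ∀ c f g → E f (λ v → c * g v) ≡ c * E f g
  E-*ʳ c f g = trans (dot-congʳ f λ u → dot-*ˡ c g (edge u)) (dot-*ʳ c f (row g))

  E-monoʳ : ∀ f {g h} → (∀ v → g v ≤ h v) → E f g ≤ E f h
  E-monoʳ f h = dot-monoʳ f λ u → dot-monoˡ (edge u) h

  E-δʳ : ∀ f x → E f (δ x) ≡ row f x
  E-δʳ f x = trans (E-sym f (δ x)) (dot-δ x (row f))

  -- Since `x` lies in `A` but is not its own neighbour, `δ x` fits beside the indicator of its
  -- neighbours in `A`.
  row<count : (A : Fin n → Bool) (x : Fin n) → A x ≡ true → row (𝟙 ∘ A) x < count A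
  row<count A x Ax = begin
    suc (row (𝟙 ∘ A) x)                    ≡⟨ +-comm 1 _ ⟩
    row (𝟙 ∘ A) x + 1                      ≡⟨ cong (row (𝟙 ∘ A) x +_) (sumF-δ x) ⟨
    row (𝟙 ∘ A) x + sumF (δ x)             ≡⟨ sumF-+ _ (δ x) ⟨
    sumF (λ v → 𝟙 (A v) * edge x v + δ x v) ≤⟨ sumF-mono pointwise ⟩
    count A                                ∎
    where
    open ≤-Reasoning
    pointwise : ∀ v → 𝟙 (A v) * edge x v + δ x v ≤ 𝟙 (A v)
    pointwise v with v ≟ x
    ... | yes refl rewrite Ax | irrefl G v = ≤-refl
    ... | no _ rewrite +-identityʳ (𝟙 (A v) * edge x v) =
      ≤-trans (*-monoʳ-≤ (𝟙 (A v)) (𝟙≤1 (adj G x v))) (≤-reflexive (*-identityʳ _))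

  -- With a = |A| ≤ k + 1, simplicity leaves every vertex of A at least k + 2 − a edges to B,
  -- and a (k + 2 − a) ≥ k + 1.
  smallCut⇒large : ∀ k (A : Fin n → Bool) (B : Fin n → ℕ) →
    (∀ x → A x ≡ true → k < row (𝟙 ∘ A) x + row B x) →
    1 ≤ count A → E (𝟙 ∘ A) B ≤ k → suc k < count A
  smallCut⇒large k A B deg nonempty small with suc (suc k) ≤? count A
  ... | yes large = large
  ... | no ¬large = contradiction small (<⇒≱ (begin-strict
    k                                     <⟨ ≤-refl ⟩
    suc k                                 ≡⟨ m+[n∸m]≡n a≤k+1 ⟨
    a + c                                 ≡⟨ cong (a +_) (*-identityˡ c) ⟨
    a + 1 * c                             ≤⟨ +-monoʳ-≤ a (*-monoˡ-≤ c nonempty) ⟩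
    a + a * c                             ≡⟨ *-suc a c ⟨
    a * suc c                             ≡⟨ *-comm a (suc c) ⟩
    suc c * a                             ≡⟨ sumF-* (suc c) (𝟙 ∘ A) ⟨
    sumF (λ x → suc c * 𝟙 (A x))          ≤⟨ sumF-mono outward ⟩
    E (𝟙 ∘ A) B                           ∎))
    where
    open ≤-Reasoning
    a = count A
    c = suc k ∸ a
    a≤k+1 : a ≤ suc k
    a≤k+1 = ≤-pred (≰⇒> ¬large)
    bound : ∀ x → A x ≡ true → suc c ≤ row B x
    bound x Ax = +-cancelˡ-≤ (row (𝟙 ∘ A) x) _ _ (begin
      row (𝟙 ∘ A) x + suc c       ≡⟨ +-suc _ c ⟩
      suc (row (𝟙 ∘ A) x) + c     ≤⟨ +-monoˡ-≤ c (row<count A x Ax) ⟩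
      a + c                       ≡⟨ m+[n∸m]≡n a≤k+1 ⟩
      suc k                       ≤⟨ deg x Ax ⟩
      row (𝟙 ∘ A) x + row B x     ∎)
    outward : ∀ x → suc c * 𝟙 (A x) ≤ 𝟙 (A x) * row B x
    outward x with A x in eq
    ... | true = ≤-trans (≤-reflexive (*-identityʳ (suc c)))
                   (≤-trans (bound x eq) (≤-reflexive (sym (*-identityˡ _))))
    ... | false = ≤-reflexive (*-zeroʳ (suc c))

  induced : {X : Fin n → Bool} → Enumeration X → Subgraph G
  induced enum = record
    { m = size
    ; H = record { adj = λ i j → adj G (elem i) (elem j)
                 ; sym = λ i j → adj-sym G (elem i) (elem j)
                 ; irrefl = λ i → irrefl G (elem i) }
    ; emb = elem ; emb-inj = elem-injective ; edges = λ _ _ e → e }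
    where open Enumeration enum

  record SmallCutOf (k : ℕ) (X : Fin n → Bool) : Set where
    field
      A : Fin n → Bool
      A⊆X : ∀ v → A v ≡ true → X v ≡ true
    B : Fin n → Bool
    B v = X v ∧ not (A v)
    field
      A-inhabited : ∃ λ u → A u ≡ true
      B-inhabited : ∃ λ v → B v ≡ true
      cut≤k : E (𝟙 ∘ A) (𝟙 ∘ B) ≤ k

  -- The dichotomy is applied to the induced subgraph on `X`. A small cut there is carried back by
  -- `extend`, and `sum-elem` rewrites its crossing number as a value of `E`.
  smallCutOf⊎edgeConnected : ∀ k X → 2 ≤ count X →
    SmallCutOf k X ⊎ Σ (Subgraph G) (λ S → EdgeConnected (suc k) (H S))
  smallCutOf⊎edgeConnected k X 2≤X
    with smallCut⊎edgeConnected k (H (induced (enumerate X))) 2≤size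
    where
    open Enumeration (enumerate X)
    2≤size : 2 ≤ size
    2≤size = subst (2 ≤_) (trans (sumF-cong λ v → sym (*-identityʳ (𝟙 (X v))))
      (trans (sym (sum-elem λ _ → 1)) (sumF-1 size))) 2≤X
  ... | inj₂ connected = inj₂ (induced (enumerate X) , connected)
  ... | inj₁ (A′ , (u , A′u) , (v , A′v) , small) = inj₁ record
    { A = A
    ; A⊆X = extend⊆ A′
    ; A-inhabited = elem u , trans (extend-elem A′ u) A′u
    ; B-inhabited = elem v , cong₂ (λ x y → x ∧ not y) (elem∈ v) (trans (extend-elem A′ v) A′v)
    ; cut≤k = subst (_≤ k) crossing≡ small }
    where
    open Enumeration (enumerate X)
    A = extend A′
    B : Fin n → Bool
    B v = X v ∧ not (A v)
    inner : ∀ u → sumF (λ j → 𝟙 (not (A (elem j))) * edge u (elem j)) ≡ row (𝟙 ∘ B) u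
    inner u = trans (sum-elem λ v → 𝟙 (not (A v)) * edge u v)
      (sumF-cong λ v → trans (sym (*-assoc (𝟙 (X v)) (𝟙 (not (A v))) (edge u v)))
        (cong (_* edge u v) (sym (𝟙-∧ (X v) (not (A v))))))
    outer : ∀ u → 𝟙 (X u) * (𝟙 (A u) * row (𝟙 ∘ B) u) ≡ 𝟙 (A u) * row (𝟙 ∘ B) u
    outer u with A u in eq
    ... | false = *-zeroʳ (𝟙 (X u))
    ... | true rewrite extend⊆ A′ u eq = *-identityˡ _
    open ≡-Reasoning
    crossing≡ : crossing (H (induced (enumerate X))) A′ ≡ E (𝟙 ∘ A) (𝟙 ∘ B)
    crossing≡ = begin
      crossing (H (induced (enumerate X))) A′
        ≡⟨ crossing-cong (H (induced (enumerate X))) (sym ∘ extend-elem A′) ⟩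
      crossing (H (induced (enumerate X))) (A ∘ elem)
        ≡⟨ sumF-cong (λ i → trans
             (sumF-cong λ j → crossing-term (A (elem i)) (A (elem j)) (adj G (elem i) (elem j)))
             (sumF-* (𝟙 (A (elem i))) (λ j → 𝟙 (not (A (elem j))) * edge (elem i) (elem j)))) ⟩
      sumF (λ i → 𝟙 (A (elem i)) * sumF (λ j → 𝟙 (not (A (elem j))) * edge (elem i) (elem j)))
        ≡⟨ sumF-cong (λ i → cong (𝟙 (A (elem i)) *_) (inner (elem i))) ⟩
      sumF (λ i → 𝟙 (A (elem i)) * row (𝟙 ∘ B) (elem i))
        ≡⟨ sum-elem (λ u → 𝟙 (A u) * row (𝟙 ∘ B) u) ⟩
      dot (𝟙 ∘ X) (λ u → 𝟙 (A u) * row (𝟙 ∘ B) u)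
        ≡⟨ sumF-cong outer ⟩
      E (𝟙 ∘ A) (𝟙 ∘ B) ∎

-- Statuses, age classes and retirement.

-- The status σ v is 0 for v in X and i + 1 for v outside X of age i; ages are never capped,
-- and σ v > L means old.
ι : ℕ → (Fin n → ℕ) → Fin n → ℕ
ι j σ v = 𝟙 (σ v ≡ᵇ j)

-- The indicator of ages below `L`, written as a sum over age classes so that its total can be
-- bounded class by class.
young : ℕ → (Fin n → ℕ) → Fin n → ℕ
young zero σ v = 0
young (suc L) σ v = young L σ v + ι (suc L) σ v

≡ᵇ-refl : ∀ m → (m ≡ᵇ m) ≡ true
≡ᵇ-refl zero = refl
≡ᵇ-refl (suc m) = ≡ᵇ-refl m

<⇒≢ᵇ : ∀ {m o} → o < m → (m ≡ᵇ o) ≡ false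
<⇒≢ᵇ {suc m} {zero} _ = refl
<⇒≢ᵇ {suc m} {suc o} (s≤s h) = <⇒≢ᵇ h

≡ᵇ-zero : ∀ m → (m ≡ᵇ 0) ≡ true → m ≡ 0
≡ᵇ-zero zero _ = refl

young≥1 : ∀ L (σ : Fin n → ℕ) v {i} → σ v ≡ suc i → i < L → 1 ≤ young L σ v
young≥1 (suc L) σ v {i} eq i<sL with m≤n⇒m<n∨m≡n (≤-pred i<sL)
... | inj₁ i<L = ≤-trans (young≥1 L σ v eq i<L) (m≤m+n _ _)
... | inj₂ refl = ≤-trans (≤-reflexive (sym one)) (m≤n+m _ _)
  where
  one : ι (suc L) σ v ≡ 1
  one rewrite eq | ≡ᵇ-refl L = refl

sumF-young : ∀ L {T} (σ : Fin n → ℕ) → (∀ j → j < L → sumF (ι (suc j) σ) ≤ T) →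
  sumF (young L σ) ≤ L * T
sumF-young {n} zero σ h = ≤-reflexive (sumF-0 n)
sumF-young (suc L) {T} σ h = begin
  sumF (young (suc L) σ)                   ≡⟨ sumF-+ (young L σ) (ι (suc L) σ) ⟩
  sumF (young L σ) + sumF (ι (suc L) σ)    ≤⟨ +-mono-≤ (sumF-young L σ λ j j<L → h j (m≤n⇒m≤1+n j<L)) (h L ≤-refl) ⟩
  L * T + T                                ≡⟨ +-comm (L * T) T ⟩
  suc L * T                                ∎
  where open ≤-Reasoning

retire : (Fin n → ℕ) → Fin n → Fin n → ℕ
retire σ x v = if does (v ≟ x) then 1 else σ v

module _ (σ : Fin n → ℕ) (x : Fin n) (σx : σ x ≡ 0) where

  retire-ι0 : ∀ v → ι 0 σ v ≡ ι 0 (retire σ x) v + δ x v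
  retire-ι0 v with v ≟ x
  ... | yes refl rewrite σx = refl
  ... | no _ = sym (+-identityʳ _)

  retire-ι1 : ∀ v → ι 1 (retire σ x) v ≡ ι 1 σ v + δ x v
  retire-ι1 v with v ≟ x
  ... | yes refl rewrite σx = refl
  ... | no _ = sym (+-identityʳ _)

  retire-ι≥2 : ∀ j v → ι (suc (suc j)) (retire σ x) v ≤ ι (suc (suc j)) σ v
  retire-ι≥2 j v with v ≟ x
  ... | yes refl = z≤n
  ... | no _ = ≤-refl

  retire-sum0 : sumF (ι 0 σ) ≡ sumF (ι 0 (retire σ x)) + 1
  retire-sum0 = trans (sumF-cong retire-ι0)
    (trans (sumF-+ (ι 0 (retire σ x)) (δ x)) (cong (sumF (ι 0 (retire σ x)) +_) (sumF-δ x)))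

  retire-sum1 : sumF (ι 1 (retire σ x)) ≡ sumF (ι 1 σ) + 1
  retire-sum1 = trans (sumF-cong retire-ι1)
    (trans (sumF-+ (ι 1 σ) (δ x)) (cong (sumF (ι 1 σ) +_) (sumF-δ x)))

-- Weights and the effect of a cut on ages.

module Weight (L : ℕ) where

  W : ℕ
  W = 3 ^ L

  W>0 : 1 ≤ W
  W>0 = m^n>0 3 L

  -- Up to age `L` this is W (2/3)^(L - i) cleared of denominators, and `W` from then on. Status 0
  -- weighs nothing, so only edges leaving `X` will count.
  wt : ℕ → ℕ
  wt zero = 0
  wt (suc i) = 3 ^ (i ⊓ L) * 2 ^ (L ∸ i)

  ω : (Fin n → ℕ) → Fin n → ℕ
  ω σ v = wt (σ v)

  wt-old : ∀ {i} → L ≤ i → wt (suc i) ≡ W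
  wt-old {i} L≤i rewrite m≥n⇒m⊓n≡n L≤i | m≤n⇒m∸n≡0 L≤i = *-identityʳ W

  -- Below age `L` one step replaces a factor 2 by a factor 3, so equality holds; from age `L` on
  -- the weight stays `W`.
  wt-grow : ∀ i → 2 * wt (suc (suc i)) ≤ 3 * wt (suc i)
  wt-grow i with suc i ≤? L
  ... | yes i<L rewrite m≤n⇒m⊓n≡m i<L | m≤n⇒m⊓n≡m (<⇒≤ i<L) | +-∸-assoc 1 i<L =
    ≤-reflexive (regroup (3 ^ i) (2 ^ (L ∸ suc i)))
    where
    regroup : ∀ a b → 2 * (3 * a * b) ≡ 3 * (a * (2 * b))
    regroup = solve-∀
  ... | no i≮L rewrite wt-old (≮⇒≥ i≮L) | wt-old (m≤n⇒m≤1+n (≮⇒≥ i≮L)) =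
    *-monoˡ-≤ W (n≤1+n 2)

  -- A vertex lies in `X`, or is young, or is old and has full weight `W`. Summed over the
  -- neighbours of a vertex, this turns a degree bound into a bound on outgoing weight.
  W≤status : ∀ (σ : Fin n → ℕ) v → W ≤ W * (ι 0 σ v + young L σ v) + ω σ v
  W≤status σ v with σ v in eq
  ... | zero = ≤-trans (≤-trans (≤-reflexive (sym (*-identityʳ W))) (*-monoʳ-≤ W (s≤s z≤n))) (m≤m+n _ _)
  ... | suc i with suc i ≤? L
  ...   | yes i<L = ≤-trans (≤-trans (≤-reflexive (sym (*-identityʳ W)))
                      (*-monoʳ-≤ W (young≥1 L σ v eq i<L))) (m≤m+n _ _)
  ...   | no i≮L = ≤-trans (≤-reflexive (sym (wt-old (≮⇒≥ i≮L)))) (m≤n+m _ _)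

  grow : ℕ → ℕ
  -- Status `suc L` is age `L`, the first age that counts as old.
  grow zero = suc L
  grow (suc i) = suc (suc i)

  -- Passing from X to its part A: vertices of X outside A become old at once.
  age : (Fin n → ℕ) → (Fin n → Bool) → Fin n → ℕ
  age σ A v = if A v then 0 else grow (σ v)

  age-ι0 : ∀ (σ : Fin n → ℕ) A v → ι 0 (age σ A) v ≡ 𝟙 (A v)
  age-ι0 σ A v with A v | σ v
  ... | true | _ = refl
  ... | false | zero = refl
  ... | false | suc _ = refl

  -- Each young class inherits its members from the class one year younger. Vertices just cut off
  -- have status `suc L`, which lies above the classes considered here.
  age-ι≥2 : ∀ (σ : Fin n → ℕ) A j → suc (suc j) ≤ L → ∀ v →
    ι (suc (suc j)) (age σ A) v ≤ ι (suc j) σ v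
  age-ι≥2 σ A j j<L v with A v | σ v
  ... | true | _ = z≤n
  ... | false | zero rewrite <⇒≢ᵇ j<L = z≤n
  ... | false | suc _ = ≤-refl

  -- Doubling avoids the fraction 3/2. Vertices of the discarded part `B` jump from weight 0 to `W`,
  -- which the second summand covers.
  age-ω : ∀ (σ : Fin n → ℕ) A (B : Fin n → ℕ) v → ι 0 σ v ≡ 𝟙 (A v) + B v →
    2 * ω (age σ A) v ≤ 3 * ω σ v + 2 * W * B v
  age-ω σ A B v part with A v | σ v
  ... | true | _ = z≤n
  ... | false | zero rewrite sym part | wt-old ≤-refl = ≤-reflexive (sym (*-identityʳ _))
  ... | false | suc i = ≤-trans (wt-grow i) (m≤m+n _ _)

  -- A cut empties the class of age 0, so the count of retirements starts afresh. With `1 ≤ L`,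
  -- vertices just cut off do not land in this class.
  age-ι1 : 1 ≤ L → ∀ (σ : Fin n → ℕ) A v → ι 1 (age σ A) v ≡ 0
  age-ι1 1≤L σ A v with A v | σ v
  ... | true | _ = refl
  ... | false | zero rewrite <⇒≢ᵇ 1≤L = refl
  ... | false | suc _ = refl

-- The descent and its potential.

module Descent (G : Graph n) (k L T D : ℕ) (1≤L : 1 ≤ L) (T<k : T < k)
  (growth : k * 2 ^ L ≤ 3 ^ L) (budget : 4 * k < suc T * D)
  (deg : ∀ v → k + (suc D + L * T) ≤ degree G v) where

  open Weight L

  Φ : (Fin n → ℕ) → ℕ
  Φ σ = E G (ι 0 σ) (ω σ)

  -- Invariant of the descent; the potential pays D W for every vertex retired since the last cut.
  record Admissible (σ : Fin n → ℕ) : Set where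
    field
      large : T < sumF (ι 0 σ) + sumF (ι 1 σ)
      potential : Φ σ + sumF (ι 1 σ) * (D * W) ≤ 4 * k * W
      classes : ∀ j → suc (suc j) ≤ L → sumF (ι (suc (suc j)) σ) ≤ T

    -- More than `T` retirements since the last cut would have cost at least (T + 1) D W, beyond the
    -- 4 k W available by `budget`.
    few-new : sumF (ι 1 σ) ≤ T
    few-new = ≮⇒≥ λ T<c → <⇒≱ (begin-strict
      4 * k * W                       <⟨ *-monoˡ-< W ⦃ >-nonZero W>0 ⦄ budget ⟩
      suc T * D * W                   ≡⟨ *-assoc (suc T) D W ⟩
      suc T * (D * W)                 ≤⟨ *-monoˡ-≤ (D * W) T<c ⟩
      sumF (ι 1 σ) * (D * W)          ∎)
      (m+n≤o⇒n≤o (Φ σ) potential)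
      where open ≤-Reasoning

    -- If `X` were empty, `large` would put more than `T` vertices in the class of age 0, against
    -- `few-new`.
    inhabited : 1 ≤ sumF (ι 0 σ)
    inhabited = ≮⇒≥ λ c<1 → <⇒≱ large
      (subst (λ c → c + sumF (ι 1 σ) ≤ T) (sym (n<1⇒n≡0 c<1)) few-new)

    few-young : sumF (young L σ) ≤ L * T
    few-young = sumF-young L σ λ { zero _ → few-new ; (suc j) j<L → classes j j<L }

  module _ {σ : Fin n → ℕ} (adm : Admissible σ) {x : Fin n} (σx : σ x ≡ 0)
           (low : row G (ι 0 σ) x ≤ k) where
    open Admissible adm

    private
      σ′ = retire σ x
      r = row G

    retire-ω : ∀ v → ω σ′ v ≡ ω σ v + 2 ^ L * δ x v
    retire-ω v with v ≟ x
    ... | yes refl rewrite σx = *-comm 1 (2 ^ L)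
    ... | no _ = sym (trans (cong (ω σ v +_) (*-zeroʳ (2 ^ L))) (+-identityʳ _))

    -- Of the at least k + (D + 1) + L T neighbours of `x`, at most k lie in `X` and at most L T are
    -- young; the others have weight `W`. Adding W (k + L T) to both sides avoids subtraction.
    outward : W * suc D ≤ r (ω σ) x
    outward = +-cancelˡ-≤ (W * (k + L * T)) _ _ (begin
      W * (k + L * T) + W * suc D              ≡⟨ regroup W k (L * T) (suc D) ⟩
      W * (k + (suc D + L * T))                ≤⟨ *-monoʳ-≤ W (deg x) ⟩
      W * degree G x                           ≡⟨ cong (W *_) (degree≡row G x) ⟩
      W * r (λ _ → 1) x                        ≡⟨ dot-*ˡ W (λ _ → 1) (edge G x) ⟨
      r (λ _ → W * 1) x                        ≤⟨ dot-monoˡ (edge G x) (λ v → ≤-trans (≤-reflexive (*-identityʳ W)) (W≤status σ v)) ⟩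
      r (λ v → W * (ι 0 σ v + young L σ v) + ω σ v) x
        ≡⟨ dot-+ˡ (λ v → W * (ι 0 σ v + young L σ v)) (ω σ) (edge G x) ⟩
      r (λ v → W * (ι 0 σ v + young L σ v)) x + r (ω σ) x
        ≡⟨ cong (_+ r (ω σ) x) (trans (dot-*ˡ W (λ v → ι 0 σ v + young L σ v) (edge G x))
             (cong (W *_) (dot-+ˡ (ι 0 σ) (young L σ) (edge G x)))) ⟩
      W * (r (ι 0 σ) x + r (young L σ) x) + r (ω σ) x
        ≤⟨ +-monoˡ-≤ _ (*-monoʳ-≤ W (+-mono-≤ low (≤-trans (row≤sumF G (young L σ) x) few-young))) ⟩
      W * (k + L * T) + r (ω σ) x              ∎)
      where
      open ≤-Reasoning
      regroup : ∀ w a b c → w * (a + b) + w * c ≡ w * (a + (c + b))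
      regroup = solve-∀

    -- Edges from `x` to the outside leave the potential. Edges from the rest of `X` to `x` enter it
    -- with weight 2^L; there are at most k of them, so `growth` bounds them by `W`.
    retire-Φ : Φ σ′ + r (ω σ) x ≤ Φ σ + W
    retire-Φ = begin
      Φ σ′ + r (ω σ) x
        ≡⟨ cong (_+ r (ω σ) x) (trans (dot-congʳ (ι 0 σ′) (λ u → dot-congˡ (edge G u) retire-ω))
             (E-+ʳ G (ι 0 σ′) (ω σ) (λ v → 2 ^ L * δ x v))) ⟩
      E G (ι 0 σ′) (ω σ) + E G (ι 0 σ′) (λ v → 2 ^ L * δ x v) + r (ω σ) x
        ≡⟨ cong (λ e → E G (ι 0 σ′) (ω σ) + e + r (ω σ) x)
             (trans (E-*ʳ G (2 ^ L) (ι 0 σ′) (δ x)) (cong (2 ^ L *_) (E-δʳ G (ι 0 σ′) x))) ⟩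
      E G (ι 0 σ′) (ω σ) + 2 ^ L * r (ι 0 σ′) x + r (ω σ) x
        ≤⟨ +-monoˡ-≤ (r (ω σ) x) (+-monoʳ-≤ (E G (ι 0 σ′) (ω σ)) new-edges) ⟩
      E G (ι 0 σ′) (ω σ) + W + r (ω σ) x
        ≡⟨ rotate (E G (ι 0 σ′) (ω σ)) W (r (ω σ) x) ⟩
      E G (ι 0 σ′) (ω σ) + r (ω σ) x + W
        ≡⟨ cong (λ e → E G (ι 0 σ′) (ω σ) + e + W) (dot-δ x (r (ω σ))) ⟨
      E G (ι 0 σ′) (ω σ) + E G (δ x) (ω σ) + W
        ≡⟨ cong (_+ W) (dot-+ˡ (ι 0 σ′) (δ x) (r (ω σ))) ⟨
      E G (λ v → ι 0 σ′ v + δ x v) (ω σ) + W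
        ≡⟨ cong (_+ W) (dot-congˡ (r (ω σ)) (retire-ι0 σ x σx)) ⟨
      Φ σ + W ∎
      where
      open ≤-Reasoning
      rotate : ∀ a b c → a + b + c ≡ a + c + b
      rotate = solve-∀
      new-edges : 2 ^ L * r (ι 0 σ′) x ≤ W
      new-edges = begin
        2 ^ L * r (ι 0 σ′) x   ≤⟨ *-monoʳ-≤ (2 ^ L) (dot-monoˡ (edge G x) λ v →
                                    ≤-trans (m≤m+n (ι 0 σ′ v) (δ x v)) (≤-reflexive (sym (retire-ι0 σ x σx v)))) ⟩
        2 ^ L * r (ι 0 σ) x    ≤⟨ *-monoʳ-≤ (2 ^ L) low ⟩
        2 ^ L * k              ≡⟨ *-comm (2 ^ L) k ⟩
        k * 2 ^ L              ≤⟨ growth ⟩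
        W                      ∎

    -- Of the drop (D + 1) W, one `W` pays for the new edges and D W for the retirement itself. In
    -- `large` the sum is unchanged, as `x` only moves from one summand to the other.
    retire-admissible : Admissible σ′
    retire-admissible = record
      { large = subst (T <_) (trans (cong (_+ sumF (ι 1 σ)) (retire-sum0 σ x σx))
          (trans (+-assoc _ 1 _) (cong (sumF (ι 0 σ′) +_)
            (trans (+-comm 1 _) (sym (retire-sum1 σ x σx)))))) large
      ; potential = +-cancelʳ-≤ W _ _ (begin
          Φ σ′ + sumF (ι 1 σ′) * (D * W) + W
            ≡⟨ cong (λ c → Φ σ′ + c * (D * W) + W) (retire-sum1 σ x σx) ⟩
          Φ σ′ + (sumF (ι 1 σ) + 1) * (D * W) + W
            ≡⟨ regroup (Φ σ′) (sumF (ι 1 σ)) D W ⟩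
          Φ σ′ + W * suc D + sumF (ι 1 σ) * (D * W)
            ≤⟨ +-monoˡ-≤ (sumF (ι 1 σ) * (D * W)) (≤-trans (+-monoʳ-≤ (Φ σ′) outward) retire-Φ) ⟩
          Φ σ + W + sumF (ι 1 σ) * (D * W)
            ≡⟨ rotate (Φ σ) W (sumF (ι 1 σ) * (D * W)) ⟩
          Φ σ + sumF (ι 1 σ) * (D * W) + W
            ≤⟨ +-monoˡ-≤ W potential ⟩
          4 * k * W + W ∎)
      ; classes = λ j h → ≤-trans (sumF-mono (retire-ι≥2 σ x σx j)) (classes j h) }
      where
      open ≤-Reasoning
      regroup : ∀ p c d w → p + (c + 1) * (d * w) + w ≡ p + w * (1 + d) + c * (d * w)
      regroup = solve-∀
      rotate : ∀ a b c → a + b + c ≡ a + c + b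
      rotate = solve-∀

  age-sum0 : ∀ (σ : Fin n → ℕ) A → sumF (ι 0 (age σ A)) ≡ count A
  age-sum0 σ A = sumF-cong (age-ι0 σ A)

  age-Φ : ∀ (σ : Fin n → ℕ) A (B : Fin n → ℕ) → (∀ v → ι 0 σ v ≡ 𝟙 (A v) + B v) →
    2 * Φ (age σ A) ≤ 3 * E G (𝟙 ∘ A) (ω σ) + 2 * W * E G (𝟙 ∘ A) B
  age-Φ σ A B part = begin
    2 * Φ (age σ A)
      ≡⟨ cong (2 *_) (dot-congˡ (row G (ω (age σ A))) (age-ι0 σ A)) ⟩
    2 * E G (𝟙 ∘ A) (ω (age σ A))
      ≡⟨ E-*ʳ G 2 (𝟙 ∘ A) (ω (age σ A)) ⟨
    E G (𝟙 ∘ A) (λ v → 2 * ω (age σ A) v)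
      ≤⟨ E-monoʳ G (𝟙 ∘ A) (λ v → age-ω σ A B v (part v)) ⟩
    E G (𝟙 ∘ A) (λ v → 3 * ω σ v + 2 * W * B v)
      ≡⟨ E-+ʳ G (𝟙 ∘ A) (λ v → 3 * ω σ v) (λ v → 2 * W * B v) ⟩
    E G (𝟙 ∘ A) (λ v → 3 * ω σ v) + E G (𝟙 ∘ A) (λ v → 2 * W * B v)
      ≡⟨ cong₂ _+_ (E-*ʳ G 3 (𝟙 ∘ A) (ω σ)) (E-*ʳ G (2 * W) (𝟙 ∘ A) B) ⟩
    3 * E G (𝟙 ∘ A) (ω σ) + 2 * W * E G (𝟙 ∘ A) B ∎
    where open ≤-Reasoning

  module _ {σ : Fin n → ℕ} (adm : Admissible σ) where
    open Admissible adm

    age-admissible : ∀ A → T < count A → Φ (age σ A) ≤ 4 * k * W → Admissible (age σ A)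
    age-admissible A T<A Φ≤ = record
      { large = ≤-trans T<A (≤-trans (≤-reflexive (sym (age-sum0 σ A))) (m≤m+n _ _))
      ; potential = ≤-trans (≤-reflexive (trans (cong (λ c → Φ (age σ A) + c * (D * W)) none-new)
          (+-identityʳ _))) Φ≤
      ; classes = λ { zero h → ≤-trans (sumF-mono (age-ι≥2 σ A 0 h)) few-new
                    ; (suc j) h → ≤-trans (sumF-mono (age-ι≥2 σ A (suc j) h))
                        (classes j (≤-trans (n≤1+n _) h)) } }
      where
      none-new : sumF (ι 1 (age σ A)) ≡ 0
      none-new = trans (sumF-cong (age-ι1 1≤L σ A)) (sumF-0 n)

    module _ (A B : Fin n → Bool) (part : ∀ v → ι 0 σ v ≡ 𝟙 (A v) + 𝟙 (B v))
             (cut≤k : E G (𝟙 ∘ A) (𝟙 ∘ B) ≤ k) where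

      part-swap : ∀ v → ι 0 σ v ≡ 𝟙 (B v) + 𝟙 (A v)
      part-swap v = trans (part v) (+-comm (𝟙 (A v)) _)

      -- Every edge leaving `X` starts in exactly one part, and each cut edge is charged once from
      -- either side. The bound 4 k W is the fixed point of m ↦ (3/4) m + k W, which is why it
      -- persists for the average of the two parts.
      total-Φ : 2 * (Φ (age σ A) + Φ (age σ B)) ≤ 2 * (2 * (4 * k * W))
      total-Φ = begin
        2 * (Φ (age σ A) + Φ (age σ B))
          ≡⟨ *-distribˡ-+ 2 (Φ (age σ A)) _ ⟩
        2 * Φ (age σ A) + 2 * Φ (age σ B)
          ≤⟨ +-mono-≤ (age-Φ σ A (𝟙 ∘ B) part) (age-Φ σ B (𝟙 ∘ A) part-swap) ⟩
        3 * E G (𝟙 ∘ A) (ω σ) + 2 * W * E G (𝟙 ∘ A) (𝟙 ∘ B)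
          + (3 * E G (𝟙 ∘ B) (ω σ) + 2 * W * E G (𝟙 ∘ B) (𝟙 ∘ A))
          ≡⟨ cong (λ e → 3 * E G (𝟙 ∘ A) (ω σ) + 2 * W * E G (𝟙 ∘ A) (𝟙 ∘ B)
               + (3 * E G (𝟙 ∘ B) (ω σ) + 2 * W * e)) (E-sym G (𝟙 ∘ B) (𝟙 ∘ A)) ⟩
        3 * E G (𝟙 ∘ A) (ω σ) + 2 * W * E G (𝟙 ∘ A) (𝟙 ∘ B)
          + (3 * E G (𝟙 ∘ B) (ω σ) + 2 * W * E G (𝟙 ∘ A) (𝟙 ∘ B))
          ≡⟨ regroup (E G (𝟙 ∘ A) (ω σ)) (E G (𝟙 ∘ B) (ω σ)) W (E G (𝟙 ∘ A) (𝟙 ∘ B)) ⟩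
        3 * (E G (𝟙 ∘ A) (ω σ) + E G (𝟙 ∘ B) (ω σ)) + 4 * E G (𝟙 ∘ A) (𝟙 ∘ B) * W
          ≡⟨ cong (λ e → 3 * e + 4 * E G (𝟙 ∘ A) (𝟙 ∘ B) * W)
               (trans (sym (dot-+ˡ (𝟙 ∘ A) (𝟙 ∘ B) (row G (ω σ))))
                 (dot-congˡ (row G (ω σ)) (sym ∘ part))) ⟩
        3 * Φ σ + 4 * E G (𝟙 ∘ A) (𝟙 ∘ B) * W
          ≤⟨ +-mono-≤ (*-monoʳ-≤ 3 (m+n≤o⇒m≤o (Φ σ) potential)) (*-monoˡ-≤ W (*-monoʳ-≤ 4 cut≤k)) ⟩
        3 * (4 * k * W) + 4 * k * W
          ≡⟨ collect (4 * k * W) ⟩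
        2 * (2 * (4 * k * W)) ∎
        where
        open ≤-Reasoning
        regroup : ∀ a b w e → 3 * a + 2 * w * e + (3 * b + 2 * w * e) ≡ 3 * (a + b) + 4 * e * w
        regroup = solve-∀
        collect : ∀ m → 3 * m + m ≡ 2 * (2 * m)
        collect = solve-∀

      one-side : Φ (age σ A) ≤ 4 * k * W ⊎ Φ (age σ B) ≤ 4 * k * W
      one-side with Φ (age σ A) ≤? 4 * k * W | Φ (age σ B) ≤? 4 * k * W
      ... | yes a | _ = inj₁ a
      ... | no _ | yes b = inj₂ b
      ... | no a | no b = contradiction (*-cancelˡ-≤ 2 total-Φ) (<⇒≱ (begin-strict
        2 * (4 * k * W)                ≡⟨ cong (4 * k * W +_) (+-identityʳ _) ⟩
        4 * k * W + 4 * k * W          <⟨ +-mono-< (≰⇒> a) (≰⇒> b) ⟩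
        Φ (age σ A) + Φ (age σ B)      ∎))
        where open ≤-Reasoning

  Goal : Set
  Goal = Σ (Subgraph G) (λ S → EdgeConnected (suc k) (H S))

  -- The parts make up `X`, where every vertex has more than k neighbours, so `smallCut⇒large`
  -- applies inside `X`.
  part-large : ∀ {σ : Fin n → ℕ} (A B : Fin n → Bool) → (∀ v → ι 0 σ v ≡ 𝟙 (A v) + 𝟙 (B v)) →
    (∀ x → σ x ≡ 0 → k < row G (ι 0 σ) x) → E G (𝟙 ∘ A) (𝟙 ∘ B) ≤ k →
    1 ≤ count A → suc k < count A
  part-large {σ} A B part high cut≤k nonempty =
    smallCut⇒large G k A (𝟙 ∘ B) deg-X nonempty cut≤k
    where
    deg-X : ∀ x → A x ≡ true → k < row G (𝟙 ∘ A) x + row G (𝟙 ∘ B) x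
    deg-X x Ax = subst (k <_)
      (trans (dot-congˡ (edge G x) part) (dot-+ˡ (𝟙 ∘ A) (𝟙 ∘ B) (edge G x)))
      (high x (in-X (part x) Ax))
      where
      in-X : ι 0 σ x ≡ 𝟙 (A x) + 𝟙 (B x) → A x ≡ true → σ x ≡ 0
      in-X e Ax′ with σ x
      ... | zero = refl
      ... | suc _ rewrite Ax′ = contradiction e λ ()

  true⇒count : (P : Fin n → Bool) → (∃ λ v → P v ≡ true) → 1 ≤ count P
  true⇒count P (v , Pv) = ≤-trans (≤-reflexive (cong 𝟙 (sym Pv))) (nonzero-sumF (𝟙 ∘ P) v)

  HasLow : (Fin n → ℕ) → Set
  HasLow σ = ∃ λ x → σ x ≡ 0 × row G (ι 0 σ) x ≤ k

  no-low⇒high : ∀ {σ : Fin n → ℕ} → ¬ HasLow σ → ∀ x → σ x ≡ 0 → k < row G (ι 0 σ) x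
  no-low⇒high none x σx = ≰⇒> λ low → none (x , σx , low)

  -- Recursion on a bound `c` for the size of `X`: retirement removes one vertex, and a cut removes
  -- a nonempty part.
  search : ∀ c (σ : Fin n → ℕ) → sumF (ι 0 σ) ≤ c → Admissible σ → Goal
  search zero σ bound adm = contradiction bound (<⇒≱ (Admissible.inhabited adm))
  search (suc c) σ bound adm
    with any? (λ x → (σ x ≟ℕ 0) ×-dec (row G (ι 0 σ) x ≤? k))
  ... | yes (x , σx , low) = search c (retire σ x)
    (≤-pred (≤-trans (≤-reflexive (trans (+-comm 1 _) (sym (retire-sum0 σ x σx)))) bound))
    (retire-admissible adm σx low)
  ... | no none with smallCutOf⊎edgeConnected G k (λ v → σ v ≡ᵇ 0) two
    where
    -- A vertex of `X` has a neighbour in `X` other than itself.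
    two : 2 ≤ sumF (ι 0 σ)
    two with sumF-nonzero (λ v → σ v ≡ᵇ 0) (Admissible.inhabited adm)
    ... | x , ex = ≤-trans (s≤s (≤-trans (s≤s z≤n) (no-low⇒high none x (≡ᵇ-zero (σ x) ex))))
                     (row<count G (λ v → σ v ≡ᵇ 0) x ex)
  ... | inj₂ found = found
  ... | inj₁ cut = continue (one-side adm A B part cut≤k)
    where
    open SmallCutOf cut
    part : ∀ v → ι 0 σ v ≡ 𝟙 (A v) + 𝟙 (B v)
    part v with A v in eq
    ... | true rewrite A⊆X v eq = refl
    ... | false with σ v ≡ᵇ 0
    ...   | true = refl
    ...   | false = refl
    A-large : suc k < count A
    A-large = part-large A B part (no-low⇒high none) cut≤k (true⇒count A A-inhabited)
    B-large : suc k < count B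
    B-large = part-large B A (part-swap adm A B part cut≤k) (no-low⇒high none)
      (subst (_≤ k) (E-sym G (𝟙 ∘ A) (𝟙 ∘ B)) cut≤k) (true⇒count B B-inhabited)
    T<1+k = m≤n⇒m≤1+n T<k
    total : count A + count B ≤ suc c
    total = ≤-trans (≤-reflexive (sym (trans (sumF-cong part) (sumF-+ (𝟙 ∘ A) (𝟙 ∘ B))))) bound
    continue : Φ (age σ A) ≤ 4 * k * W ⊎ Φ (age σ B) ≤ 4 * k * W → Goal
    continue (inj₁ Φ≤) = search c (age σ A)
      (≤-trans (≤-reflexive (age-sum0 σ A))
        (≤-pred (≤-trans (+-monoˡ-≤ (count A) (≤-trans (s≤s z≤n) B-large))
          (≤-trans (≤-reflexive (+-comm (count B) _)) total))))
      (age-admissible adm A (<-trans T<1+k A-large) Φ≤)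
    continue (inj₂ Φ≤) = search c (age σ B)
      (≤-trans (≤-reflexive (age-sum0 σ B))
        (≤-pred (≤-trans (+-monoˡ-≤ (count B) (≤-trans (s≤s z≤n) A-large)) total)))
      (age-admissible adm B (<-trans T<1+k B-large) Φ≤)

  -- The descent starts with `X` the whole vertex set. Nothing lies outside, so the potential is 0,
  -- and `large` holds because T < k and some vertex has at least k neighbours.
  edgeConnectedSubgraph : 1 ≤ n → Goal
  edgeConnectedSubgraph 1≤n = search n (λ _ → 0) (≤-reflexive (sumF-1 n)) record
    { large = <-≤-trans T<n (≤-trans (≤-reflexive (sym (sumF-1 n))) (m≤m+n _ _))
    ; potential = ≤-trans (≤-reflexive (cong₂ _+_ Φ≡0 (cong (_* (D * W)) (sumF-0 n)))) z≤n
    ; classes = λ _ _ → ≤-trans (≤-reflexive (sumF-0 n)) z≤n }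
    where
    vertex : Fin n
    vertex = fromℕ< 1≤n
    T<n : T < n
    T<n = <-≤-trans T<k (≤-trans (m≤m+n k _) (≤-trans (deg vertex)
      (≤-trans (≤-reflexive (degree≡row G vertex))
        (≤-trans (row≤sumF G (λ _ → 1) vertex) (≤-reflexive (sumF-1 n))))))
    Φ≡0 : Φ (λ _ → 0) ≡ 0
    -- All weights compute to 0, which is 0 times the constant 1.
    Φ≡0 = E-*ʳ G 0 (λ _ → 1) (λ _ → 0)

-- Integer roots and logarithms; choice of parameters.

-- As `f` dominates the identity, it exceeds k at k + 1; searching downwards from there finds a
-- place where it crosses k.
bracket : (f : ℕ → ℕ) → (∀ i → i ≤ f i) → ∀ k → f 0 ≤ k → ∃ λ r → f r ≤ k × k < f (suc r)
bracket f grows k f0≤k = from (suc k) (≤-trans (n<1+n k) (grows (suc k)))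
  where
  from : ∀ b → k < f b → ∃ λ r → f r ≤ k × k < f (suc r)
  from zero k<f0 = contradiction f0≤k (<⇒≱ k<f0)
  from (suc b) k<f with f b ≤? k
  ... | yes fb≤k = b , fb≤k , k<f
  ... | no fb≰k = from b (≰⇒> fb≰k)

sqrt : ∀ k → ∃ λ r → r * r ≤ k × k < suc r * suc r
sqrt k = bracket (λ i → i * i) square k z≤n
  where
  square : ∀ i → i ≤ i * i
  square zero = z≤n
  square (suc i) = m≤m*n (suc i) (suc i)

n<2^n : ∀ i → i < 2 ^ i
n<2^n zero = s≤s z≤n
n<2^n (suc i) = begin-strict
  suc i            <⟨ s≤s (n<2^n i) ⟩
  suc (2 ^ i)      ≤⟨ +-monoˡ-≤ (2 ^ i) (m^n>0 2 i) ⟩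
  2 ^ i + 2 ^ i    ≡⟨ cong (2 ^ i +_) (+-identityʳ _) ⟨
  2 * 2 ^ i        ∎
  where open ≤-Reasoning

log : ∀ k → 1 ≤ k → ∃ λ l → 2 ^ l ≤ k × k < 2 ^ suc l
log k 1≤k = bracket (2 ^_) (λ i → <⇒≤ (n<2^n i)) k 1≤k

^-distribʳ-* : ∀ m n o → (m * n) ^ o ≡ m ^ o * n ^ o
^-distribʳ-* m n zero = refl
^-distribʳ-* m n (suc o) rewrite ^-distribʳ-* m n o = regroup m n (m ^ o) (n ^ o)
  where
  regroup : ∀ a b c d → a * b * (c * d) ≡ a * c * (b * d)
  regroup = solve-∀

-- With t = l / 2q: 8l + 14 ≤ 30q (t + 1) ≤ (t + 1)² ≤ (2 ^ t)².
poly≤exp : ∀ q → 1 ≤ q → ∀ l → 60 * (q * q) ≤ l → (8 * l + 14) ^ q ≤ 2 ^ l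
poly≤exp q@(suc _) 1≤q l big = begin
  (8 * l + 14) ^ q        ≤⟨ ^-monoˡ-≤ q base ⟩
  (2 ^ t * 2 ^ t) ^ q     ≡⟨ cong (_^ q) (^-distribˡ-+-* 2 t t) ⟨
  (2 ^ (t + t)) ^ q       ≡⟨ ^-*-assoc 2 (t + t) q ⟩
  2 ^ ((t + t) * q)       ≤⟨ ^-monoʳ-≤ 2 (≤-trans (≤-reflexive (double t q)) (m/n*n≤m l (2 * q))) ⟩
  2 ^ l                   ∎
  where
  open ≤-Reasoning
  t = l / (2 * q)
  double : ∀ t q → (t + t) * q ≡ t * (2 * q)
  double = solve-∀
  l<[t+1]2q : l < suc t * (2 * q)
  l<[t+1]2q = begin-strict
    l                              ≡⟨ m≡m%n+[m/n]*n l (2 * q) ⟩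
    l % (2 * q) + t * (2 * q)  <⟨ +-monoˡ-< (t * (2 * q)) (m%n<n l (2 * q)) ⟩
    suc t * (2 * q)                ∎
  30q≤t+1 : 30 * q ≤ suc t
  30q≤t+1 = <⇒≤ (*-cancelʳ-< (2 * q) (30 * q) (suc t) (begin-strict
    30 * q * (2 * q)       ≡⟨ sixty q ⟩
    60 * (q * q)           ≤⟨ big ⟩
    l                      <⟨ l<[t+1]2q ⟩
    suc t * (2 * q)        ∎))
    where
    sixty : ∀ q → 30 * q * (2 * q) ≡ 60 * (q * q)
    sixty = solve-∀
  base : 8 * l + 14 ≤ 2 ^ t * 2 ^ t
  base = begin
    8 * l + 14                              ≤⟨ +-mono-≤ (*-monoʳ-≤ 8 (<⇒≤ l<[t+1]2q)) (*-monoʳ-≤ 14 (*-mono-≤ 1≤q (s≤s z≤n))) ⟩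
    8 * (suc t * (2 * q)) + 14 * (q * suc t) ≡⟨ collect q (suc t) ⟩
    30 * q * suc t                          ≤⟨ *-monoˡ-≤ (suc t) 30q≤t+1 ⟩
    suc t * suc t                           ≤⟨ *-mono-≤ (n<2^n t) (n<2^n t) ⟩
    2 ^ t * 2 ^ t                           ∎
    where
    collect : ∀ q n → 8 * (n * (2 * q)) + 14 * (q * n) ≡ 30 * q * n
    collect = solve-∀

-- For r = ⌊√k⌋ and l = ⌊log₂ k⌋ take T = D = 2(r + 1) and L = 2(l + 1). Then
-- D + L T + 1 ≤ (8l + 14) r, and (8l + 14)^q ≤ k once k is large.
record Parameters (p q k : ℕ) : Set where
  field
    L T D : ℕ
    1≤L : 1 ≤ L
    T<k : T < k
    growth : k * 2 ^ L ≤ 3 ^ L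
    budget : 4 * k < suc T * D
    excess : ∀ e → k ^ (q + 2 * p) ≤ e ^ (2 * q) → suc D + L * T ≤ e

parameters : ∀ p q → 1 ≤ p → 1 ≤ q → ∀ k → 16 + 2 ^ (60 * (q * q)) ≤ k → Parameters p q k
parameters p q 1≤p 1≤q k k₀≤k = record
  { L = L ; T = T ; D = T ; 1≤L = s≤s z≤n ; T<k = T<k
  ; growth = growth ; budget = budget ; excess = excess }
  where
  open ≤-Reasoning
  16≤k : 16 ≤ k
  16≤k = m+n≤o⇒m≤o 16 k₀≤k
  r = proj₁ (sqrt k)
  r²≤k = proj₁ (proj₂ (sqrt k))
  k<[1+r]² = proj₂ (proj₂ (sqrt k))
  l = proj₁ (log k (≤-trans (s≤s z≤n) 16≤k))
  2^l≤k = proj₁ (proj₂ (log k (≤-trans (s≤s z≤n) 16≤k)))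
  k<2^1+l = proj₂ (proj₂ (log k (≤-trans (s≤s z≤n) 16≤k)))
  L = 2 * suc l
  T = 2 * suc r
  3≤r : 3 ≤ r
  3≤r = ≮⇒≥ λ r<3 → <⇒≱ (<-≤-trans k<[1+r]² (*-mono-≤ r<3 r<3)) (≤-trans (m≤m+n 9 7) 16≤k)
  T<k : T < k
  T<k = begin-strict
    2 * suc r        ≡⟨ expand r ⟩
    2 * r + 2        <⟨ +-monoʳ-< (2 * r) (3≤r) ⟩
    2 * r + r        ≡⟨ collect r ⟩
    3 * r            ≤⟨ *-monoˡ-≤ r 3≤r ⟩
    r * r            ≤⟨ r²≤k ⟩
    k                ∎
    where
    expand : ∀ r → 2 * (1 + r) ≡ 2 * r + 2
    expand = solve-∀
    collect : ∀ r → 2 * r + r ≡ 3 * r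
    collect = solve-∀
  -- The factor 2 in `L` makes this the comparison of 8 with 9: k < 2^(l+1) and 4^(l+1) = 2^L give
  -- 8^(l+1), while 3^L = 9^(l+1).
  growth : k * 2 ^ L ≤ 3 ^ L
  growth = begin
    k * 2 ^ L                       ≤⟨ *-monoˡ-≤ (2 ^ L) (<⇒≤ k<2^1+l) ⟩
    2 ^ suc l * 2 ^ (2 * suc l)     ≡⟨ cong (2 ^ suc l *_) (^-*-assoc 2 2 (suc l)) ⟨
    2 ^ suc l * 4 ^ suc l           ≡⟨ ^-distribʳ-* 2 4 (suc l) ⟨
    8 ^ suc l                       ≤⟨ ^-monoˡ-≤ (suc l) (n≤1+n 8) ⟩
    9 ^ suc l                       ≡⟨ ^-*-assoc 3 2 (suc l) ⟩
    3 ^ L                           ∎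
  budget : 4 * k < suc T * T
  budget = begin-strict
    4 * k                       <⟨ *-monoʳ-< 4 k<[1+r]² ⟩
    4 * (suc r * suc r)         ≡⟨ square (suc r) ⟩
    T * T                       ≤⟨ *-monoˡ-≤ T (n≤1+n T) ⟩
    suc T * T                   ∎
    where
    square : ∀ r → 4 * (r * r) ≡ 2 * r * (2 * r)
    square = solve-∀
  S = suc T + L * T
  -- Otherwise k < 2^(l+1) ≤ 2^(60 q q), against the choice of the threshold.
  60q²≤l : 60 * (q * q) ≤ l
  60q²≤l = ≤-pred (≰⇒> λ 1+l≤ → <⇒≱ (<-≤-trans k<2^1+l (^-monoʳ-≤ 2 1+l≤))
    (≤-trans (m≤n+m _ 16) k₀≤k))
  instance
    k≢0 : NonZero k
    k≢0 = >-nonZero (≤-trans (s≤s z≤n) 16≤k)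
  c = 8 * l + 14
  S≤cr : S ≤ c * r
  S≤cr = begin
    suc T + L * T                        ≡⟨ expand l (suc r) ⟩
    1 + (4 * l + 6) * suc r              ≤⟨ +-mono-≤ r>0 (*-monoʳ-≤ (4 * l + 6) (+-monoˡ-≤ r r>0)) ⟩
    r + (4 * l + 6) * (r + r)            ≤⟨ m≤m+n _ r ⟩
    r + (4 * l + 6) * (r + r) + r        ≡⟨ collect l r ⟩
    c * r                                ∎
    where
    r>0 : 1 ≤ r
    r>0 = ≤-trans (s≤s z≤n) 3≤r
    expand : ∀ l r → 1 + 2 * r + 2 * (1 + l) * (2 * r) ≡ 1 + (4 * l + 6) * r
    expand = solve-∀
    collect : ∀ l r → r + (4 * l + 6) * (r + r) + r ≡ (8 * l + 14) * r
    collect = solve-∀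
  -- From S ≤ c r and r r ≤ k, the power is at most c^(2q) k^q. Each of the two factors c^q is at
  -- most 2^l ≤ k, and the resulting k^2 is absorbed by k^(2p) because p ≥ 1.
  S-power : S ^ (2 * q) ≤ k ^ (q + 2 * p)
  S-power = begin
    S ^ (2 * q)                          ≤⟨ ^-monoˡ-≤ (2 * q) S≤cr ⟩
    (c * r) ^ (2 * q)                    ≡⟨ ^-*-assoc (c * r) 2 q ⟨
    ((c * r) ^ 2) ^ q                    ≡⟨ cong (_^ q) (square c r) ⟩
    (c * c * (r * r)) ^ q                ≤⟨ ^-monoˡ-≤ q (*-monoʳ-≤ (c * c) r²≤k) ⟩
    (c * c * k) ^ q                      ≡⟨ ^-distribʳ-* (c * c) k q ⟩
    (c * c) ^ q * k ^ q                  ≡⟨ cong (_* k ^ q) (^-distribʳ-* c c q) ⟩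
    c ^ q * c ^ q * k ^ q                ≤⟨ *-monoˡ-≤ (k ^ q) (*-mono-≤ c^q≤k c^q≤k) ⟩
    k * k * k ^ q                        ≡⟨ *-comm (k * k) (k ^ q) ⟩
    k ^ q * (k * k)                      ≡⟨ cong (λ j → k ^ q * (k * j)) (*-identityʳ k) ⟨
    k ^ q * k ^ 2                        ≡⟨ ^-distribˡ-+-* k q 2 ⟨
    k ^ (q + 2)                          ≤⟨ ^-monoʳ-≤ k (+-monoʳ-≤ q (*-monoʳ-≤ 2 1≤p)) ⟩
    k ^ (q + 2 * p)                      ∎
    where
    c^q≤k : c ^ q ≤ k
    c^q≤k = ≤-trans (poly≤exp q 1≤q l 60q²≤l) 2^l≤k
    square : ∀ c r → c * r * (c * r * 1) ≡ c * c * (r * r)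
    square = solve-∀
  excess : ∀ e → k ^ (q + 2 * p) ≤ e ^ (2 * q) → S ≤ e
  -- Powers with the positive exponent 2q are strictly increasing, so e < S would contradict
  -- `S-power`.
  excess e h = ≮⇒≥ λ e<S →
    <⇒≱ (^-monoˡ-< (2 * q) ⦃ >-nonZero (*-mono-≤ {1} {2} (s≤s z≤n) 1≤q) ⦄ e<S) (≤-trans S-power h)

theorem5 : (p q : ℕ) → 1 ≤ p → 1 ≤ q →
    ∃ λ k₀ → (k : ℕ) → k₀ ≤ k →
    (n : ℕ) → 1 ≤ n → (G : Graph n) →
    ((v : _) → DegBound p q k (degree G v)) →
    Σ (Subgraph G) (λ S → EdgeConnected (suc k) (H S))
-- The summand 16 ensures that the integer square root is at least 3; the power of 2 makes the
-- logarithm large enough for `poly≤exp`.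
theorem5 p q 1≤p 1≤q = 16 + 2 ^ (60 * (q * q)) , λ k k₀≤k n 1≤n G bound →
  let open Parameters (parameters p q 1≤p 1≤q k k₀≤k)
      deg : ∀ v → k + (suc D + L * T) ≤ degree G v
      deg v = ≤-trans (+-monoʳ-≤ k (excess (degree G v ∸ k) (proj₂ (bound v))))
        (≤-reflexive (m+[n∸m]≡n (proj₁ (bound v))))
  in Descent.edgeConnectedSubgraph G k L T D 1≤L T<k growth budget deg 1≤n
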